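{- If $G$ is a 3-connected almost wheel-free graph, then $G$ is minimally 3-connected.
   Context: Graphs are finite, simple and undirected. A wheel $(C,v)$ in a graph $G$ consists of a cycle $C$ of $G$ (as a subgraph, not necessarily induced; called the rim) and a vertex $v\in V(G)\setminus V(C)$ (the center) having at least three neighbors in $V(C)$. $W(G)$ denotes the set of all vertices $u$ of $G$ such that at least one wheel of $G$ is centered at $u$. A graph $G$ is almost wheel-free if $W(G)$ is either empty, or made of a single vertex of degree 3 in $G$, or made of two adjacent vertices, both of degree 3 in $G$ (in particular every wheel-free graph, i.e. graph with $W(G)=\emptyset$, is almost wheel-free). $\kappa(G)$ denotes the (vertex-)connectivity of $G$. An edge $e$ of $G$ is essential if $\kappa(G\setminus e)<\kappa(G)$, where $G\setminus e$ is $G$ with the edge $e$ deleted (its ends are kept). A graph is minimally $k$-connected if it has connectivity exactly $k$ and all its edges are essential. -}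

module Defs where

open import Data.Fin using (Fin; _≟_)
open import Data.Fin.Subset using (Subset; _∉_; ∣_∣)
open import Data.List using (List; _∷_; _∷ʳ_; length; filter)
import Data.List.Membership.Propositional as List
open import Data.List.Relation.Unary.Linked using (Linked)
open import Data.List.Relation.Unary.Unique.Propositional using (Unique)
open import Data.Nat using (ℕ; _≤_; _<_)
open import Data.Product using (_×_; _,_; ∃-syntax)
open import Data.Sum using (_⊎_; inj₁; inj₂)
open import Data.Vec using (tabulate)
open import Level using (0ℓ)
open import Relation.Binary using (Rel; Decidable; Symmetric; Irreflexive)
open import Relation.Binary.Construct.Closure.ReflexiveTransitive using (Star)
open import Relation.Binary.PropositionalEquality using (_≡_)
open import Relation.Nullary using (¬_; does; ¬?; _×-dec_; _⊎-dec_)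
open import Relation.Unary using (Pred; Empty; _≐_; ｛_｝; _∪_)

record Graph (n : ℕ) : Set₁ where
  field
    Adj    : Rel (Fin n) 0ℓ
    adj?   : Decidable Adj
    sym    : Symmetric Adj
    irrefl : Irreflexive _≡_ Adj

open Graph public

private variable
  n : ℕ

neighbours : Graph n → Fin n → Subset n
neighbours G v = tabulate λ u → does (adj? G v u)

degree : Graph n → Fin n → ℕ
degree G v = ∣ neighbours G v ∣

SamePair : (u v x y : Fin n) → Set
SamePair u v x y = (x ≡ u × y ≡ v) ⊎ (x ≡ v × y ≡ u)

deleteEdge : Graph n → Fin n → Fin n → Graph n
deleteEdge G u v = record
  { Adj    = λ x y → Adj G x y × ¬ SamePair u v x y
  ; adj?   = λ x y → adj? G x y ×-dec
               ¬? (((x ≟ u) ×-dec (y ≟ v)) ⊎-dec ((x ≟ v) ×-dec (y ≟ u)))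
  ; sym    = λ { (a , ne) → sym G a , λ
               { (inj₁ (p , q)) → ne (inj₂ (q , p))
               ; (inj₂ (p , q)) → ne (inj₁ (q , p)) } }
  ; irrefl = λ { eq (a , _) → irrefl G eq a }
  }

-- The graph obtained from G by deleting the vertices in X is not rebuilt on a
-- smaller vertex type: its walks are the walks of G that stay outside X.
AdjOutside : Graph n → Subset n → Rel (Fin n) 0ℓ
AdjOutside G X x y = Adj G x y × x ∉ X × y ∉ X

ConnectedOutside : Graph n → Subset n → Set
ConnectedOutside G X = ∀ {x y} → x ∉ X → y ∉ X → Star (AdjOutside G X) x y

KConnected : ℕ → Graph n → Set
KConnected {n} k G = k < n × (∀ X → ∣ X ∣ < k → ConnectedOutside G X)

-- κ(G) = k, where κ(G) is the greatest k such that G is k-connected; in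
-- particular κ of the complete graph on n ≥ 1 vertices is n − 1.
HasConnectivity : Graph n → ℕ → Set
HasConnectivity G k = KConnected k G × (∀ {j} → KConnected j G → j ≤ k)

-- κ(G \ uv) < κ(G)
Essential : Graph n → Fin n → Fin n → Set
Essential G u v =
  ∃[ j ] ∃[ k ] HasConnectivity (deleteEdge G u v) j × HasConnectivity G k × j < k

MinimallyConnected : ℕ → Graph n → Set
MinimallyConnected k G =
  HasConnectivity G k × (∀ {u v} → Adj G u v → Essential G u v)

-- A cycle is given by listing its vertices once, in cyclic order, from any
-- starting vertex; chords are allowed.
record Cycle (G : Graph n) : Set where
  field
    start    : Fin n
    rest     : List (Fin n)
    distinct : Unique (start ∷ rest)
    closed   : Linked (Adj G) (start ∷ rest ∷ʳ start)
    long     : 2 ≤ length rest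

  vertices : List (Fin n)
  vertices = start ∷ rest

-- Since the vertices of the rim are listed without repetition, the filtered
-- list counts the neighbours of v on the rim.
record Wheel (G : Graph n) (v : Fin n) : Set where
  field
    rim    : Cycle G
    off    : v List.∉ Cycle.vertices rim
    spokes : 3 ≤ length (filter (adj? G v) (Cycle.vertices rim))

W : Graph n → Pred (Fin n) 0ℓ
W G v = Wheel G v

AlmostWheelFree : Graph n → Set
AlmostWheelFree G =
    Empty (W G)
  ⊎ (∃[ u ] W G ≐ ｛ u ｝ × degree G u ≡ 3)
  ⊎ (∃[ u ] ∃[ v ] Adj G u v × W G ≐ ｛ u ｝ ∪ ｛ v ｝
       × degree G u ≡ 3 × degree G v ≡ 3)

{-# OPTIONS --safe #-}
module Submission where

-- If H = G ∖ uv is 3-connected then u, of degree at least 4 in G, is the centre of a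
-- wheel of G, so G is not almost wheel-free.  For the rim one needs a cycle of the
-- 2-connected graph H − u through v and two neighbours of u in H.  Take a cycle Z of
-- H − u through two such neighbours a and b, and, if v is not on Z, three paths of H
-- from v to Z ∪ {u} that share only v.  If all three end on Z, their ends cut Z into
-- three arcs; replace an arc that a and b can spare by two of the paths.  Otherwise one
-- path reaches u through a neighbour x, and Menger's theorem in H − u yields a path from
-- v through x to another vertex s of Z or of the remaining two paths.  If s is on one of
-- these paths, that path is rerouted through x and closed up along an arc of Z containing
-- a; if s is on Z, there are again three paths from v to Z.
--
-- Applied after the deletion of an edge, which lowers the connectivity by at most one,
-- this shows both that κ(G) ≤ 3 and that every edge is essential.

open import Data.Bool using (true; false)
open import Data.Empty using (⊥-elim)
open import Data.Fin using (Fin; zero; suc; _≟_; inject≤; punchOut; fromℕ<)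
import Data.Fin.Properties as Fin
import Data.Fin.Subset as Subset
open Subset using (Subset; ⁅_⁆; _∪_; ∣_∣)
import Data.Fin.Subset.Properties as Subset
open import Data.List
  using (List; []; _∷_; _++_; _∷ʳ_; [_]; length; filter; lookup; allFin; cartesianProduct)
import Data.List.Membership.DecPropositional as DecMembership
open import Data.List.Membership.Propositional using (_∈_; _∉_; find)
open import Data.List.Membership.Propositional.Properties
import Data.List.Properties as List
open import Data.List.Relation.Binary.Disjoint.Propositional using (Disjoint)
open import Data.List.Relation.Binary.Subset.Propositional using (_⊆_)
open import Data.List.Relation.Unary.All as All using (All; []; _∷_)
open import Data.List.Relation.Unary.All.Properties
  using (¬Any⇒All¬; All¬⇒¬Any; ¬All⇒Any¬; ++⁻ˡ; ++⁻ʳ)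
open import Data.List.Relation.Unary.AllPairs as AllPairs using ([]; _∷_)
open import Data.List.Relation.Unary.Any using (here; there; index)
open import Data.List.Relation.Unary.Any.Properties using (lookup-index)
open import Data.List.Relation.Unary.Linked using (Linked; [-]; _∷_)
open import Data.List.Relation.Unary.Unique.Propositional using (Unique)
import Data.List.Relation.Unary.Unique.Propositional.Properties as Unique
open import Data.Nat using (ℕ; suc; _+_; _≤_; _<_; z≤n; s≤s; s≤s⁻¹; _≤?_)
import Data.Nat.Properties as ℕ
open import Data.Product using (_×_; _,_; proj₁; proj₂; ∃-syntax; ∃₂)
open import Data.Sum as Sum using (_⊎_; inj₁; inj₂; [_,_]′)
open import Data.Vec using ([]; _∷_)
open import Data.Vec.Properties using (lookup⇒[]=; lookup∘tabulate)
open import Function using (_∘_; Injective; case_of_; id)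
open import Level using (0ℓ)
open import Relation.Binary using (Rel; Symmetric) renaming (Decidable to Decidable₂)
open import Relation.Binary.Construct.Closure.ReflexiveTransitive as Star
  using (Star; ε; _◅_; _◅◅_)
open import Relation.Binary.PropositionalEquality hiding ([_])
open import Relation.Nullary using (¬_; Dec; yes; no; contradiction; _×-dec_; _⊎-dec_; ¬?)
open import Relation.Nullary.Decidable using (dec-true; decidable-stable)
open import Relation.Unary using (Pred; Decidable)
open import Defs hiding (sym)

private variable
  k m n : ℕ

-- The index lists the vertices of the walk except its first one; a closed walk without
-- repetitions in this list is thus a cycle.
data Walk {n} (R : Rel (Fin n) 0ℓ) : Fin n → Fin n → List (Fin n) → Set where
  []  : ∀ {a} → Walk R a a []
  _∷_ : ∀ {a b c l} → R a b → Walk R b c l → Walk R a c (b ∷ l)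

-- Lists without repetition and injections between finite sets.

head∉tail : ∀ {A : Set} {x : A} {xs} → Unique (x ∷ xs) → x ∉ xs
head∉tail (x∉ ∷ _) = All¬⇒¬Any x∉

infixr 5 _∷!_
_∷!_ : ∀ {A : Set} {x : A} {xs} → x ∉ xs → Unique xs → Unique (x ∷ xs)
x∉ ∷! u = ¬Any⇒All¬ _ x∉ ∷ u

lookup-injective : ∀ {A : Set} {xs : List A} → Unique xs →
  Injective _≡_ _≡_ (lookup xs)
lookup-injective {xs = _ ∷ xs} u {zero}  {zero}  eq = refl
lookup-injective {xs = _ ∷ xs} u {zero}  {suc j} eq =
  contradiction (subst (_∈ xs) (sym eq) (∈-lookup j)) (head∉tail u)
lookup-injective {xs = _ ∷ xs} u {suc i} {zero}  eq =
  contradiction (subst (_∈ xs) eq (∈-lookup i)) (head∉tail u)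
lookup-injective {xs = _ ∷ xs} (_ ∷ u) {suc i} {suc j} eq =
  cong suc (lookup-injective u eq)

injective⇒surjective : ∀ {f : Fin k → Fin m} → Injective _≡_ _≡_ f → m ≤ k →
  ∀ j → ∃[ i ] f i ≡ j
injective⇒surjective {m = suc m} {f = f} inj m<k j with Fin.any? (λ i → f i ≟ j)
... | yes hit  = hit
... | no  miss = contradiction
  (Fin.injective⇒≤ {f = λ i → punchOut (miss ∘ (i ,_) ∘ sym)}
    λ {i} {i′} eq → inj (Fin.punchOut-injective
      (miss ∘ (i ,_) ∘ sym) (miss ∘ (i′ ,_) ∘ sym) eq))
  (ℕ.<⇒≱ m<k)

-- Walks, separators and linkages.

module _ {R : Rel (Fin n) 0ℓ} where

  infixr 5 _++ʷ_
  _++ʷ_ : ∀ {a b c l l′} → Walk R a b l → Walk R b c l′ → Walk R a c (l ++ l′)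
  []      ++ʷ w′ = w′
  (r ∷ w) ++ʷ w′ = r ∷ (w ++ʷ w′)

  end∈ : ∀ {a b l} → Walk R a b l → b ∈ a ∷ l
  end∈ []      = here refl
  end∈ (_ ∷ w) = there (end∈ w)

-- The last vertex of a walk along avoiding R T is not tested.
avoiding : Rel (Fin n) 0ℓ → List (Fin n) → Rel (Fin n) 0ℓ
avoiding R T x y = R x y × x ∉ T

-- The condition `b ∉ T` covers the last vertex, which `avoiding` leaves untested.
Separates : Rel (Fin n) 0ℓ → (A B : Pred (Fin n) 0ℓ) → List (Fin n) → Set
Separates R A B T = ∀ {a b} → A a → B b → b ∉ T → ¬ Star (avoiding R T) a b

record Linkage (R : Rel (Fin n) 0ℓ) (A B : Pred (Fin n) 0ℓ) (k : ℕ) : Set where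
  field
    source   : Fin k → Fin n
    target   : Fin k → Fin n
    tail     : Fin k → List (Fin n)
    walk     : ∀ i → Walk R (source i) (target i) (tail i)
    unique   : ∀ i → Unique (source i ∷ tail i)
    source∈  : ∀ i → A (source i)
    target∈  : ∀ i → B (target i)
    disjoint : ∀ {i j z} → z ∈ source i ∷ tail i → z ∈ source j ∷ tail j → i ≡ j

  target-path : ∀ i → target i ∈ source i ∷ tail i
  target-path i = end∈ (walk i)

open Linkage

module _ {R : Rel (Fin n) 0ℓ} {A B : Pred (Fin n) 0ℓ} where

  reindex : Linkage R A B k → (f : Fin m → Fin k) → Injective _≡_ _≡_ f → Linkage R A B m
  reindex L f inj = record
    { source   = source L ∘ f
    ; target   = target L ∘ f
    ; tail     = tail L ∘ f
    ; walk     = walk L ∘ f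
    ; unique   = unique L ∘ f
    ; source∈  = source∈ L ∘ f
    ; target∈  = target∈ L ∘ f
    ; disjoint = λ p q → inj (disjoint L p q)
    }

-- Distinct values that are at least as many as the entries of `T` occupy all its positions, so the
-- family can be put in the order of `T`. This matches the ends of two linkages at a separator.
inverse-lookup : ∀ {T : List (Fin n)} (v : Fin k → Fin n) → Injective _≡_ _≡_ v →
  (∀ i → v i ∈ T) → length T ≤ k →
  ∃[ f ] Injective _≡_ _≡_ f × (∀ j → v (f j) ≡ lookup T j)
inverse-lookup {T = T} v inj v∈ T≤k = f , f-inj , v∘f
  where
  pos-inj : Injective _≡_ _≡_ (index ∘ v∈)
  pos-inj {i} {j} eq = inj (trans (lookup-index (v∈ i))
    (trans (cong (lookup T) eq) (sym (lookup-index (v∈ j)))))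
  onto = injective⇒surjective pos-inj T≤k
  f = proj₁ ∘ onto
  f-inj : Injective _≡_ _≡_ f
  f-inj {i} {j} eq = trans (sym (proj₂ (onto i))) (trans (cong (index ∘ v∈) eq) (proj₂ (onto j)))
  v∘f : ∀ j → v (f j) ≡ lookup T j
  v∘f j = trans (lookup-index (v∈ (f j))) (cong (lookup T) (proj₂ (onto j)))

module _ {R : Rel (Fin n) 0ℓ} {S : List (Fin n)} where

  -- A vertex that the path leaves is not its end, and only the end may lie in `S`.
  prefix-avoids : ∀ {a b z l} → Walk R a b l → Unique (a ∷ l) →
    (∀ {w} → w ∈ a ∷ l → w ∈ S → w ≡ b) → z ∈ a ∷ l → Star (avoiding R S) a z
  prefix-avoids w u S⇒b (here refl) = ε
  prefix-avoids (r ∷ w) u S⇒b (there z∈) =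
    (r , λ a∈S → head∉tail u (subst (_∈ _) (sym (S⇒b (here refl) a∈S)) (end∈ w)))
    ◅ prefix-avoids w (AllPairs.tail u) (S⇒b ∘ there) z∈

  suffix-avoids : ∀ {a b z l} → Walk R a b l → (∀ {w} → w ∈ l → w ∉ S) →
    z ∈ a ∷ l → z ∉ S → Star (avoiding R S) z b × b ∉ S
  suffix-avoids [] l∉S (here refl) z∉S = ε , z∉S
  suffix-avoids (r ∷ w) l∉S (here refl) z∉S =
    let p , b∉S = suffix-avoids w (l∉S ∘ there) (here refl) (l∉S (here refl))
    in (r , z∉S) ◅ p , b∉S
  suffix-avoids (r ∷ w) l∉S (there z∈) z∉S = suffix-avoids w (l∉S ∘ there) z∈ z∉S

module _ {A : Set} where

  unique-++⁻ : ∀ xs {ys : List A} → Unique (xs ++ ys) → Unique xs × Unique ys × Disjoint xs ys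
  unique-++⁻ []       u = [] , u , λ ()
  unique-++⁻ (x ∷ xs) {ys} (x∉ ∷ u) =
    let u₁ , u₂ , d = unique-++⁻ xs u
    in ++⁻ˡ xs x∉ ∷ u₁ , u₂ ,
       λ { (here refl , w∈) → All¬⇒¬Any (++⁻ʳ xs x∉) w∈ ; (there w∈ , w∈′) → d (w∈ , w∈′) }

  unique-++-comm : ∀ xs {ys : List A} → Unique (xs ++ ys) → Unique (ys ++ xs)
  unique-++-comm xs u =
    let u₁ , u₂ , d = unique-++⁻ xs u in Unique.++⁺ u₂ u₁ λ (p , q) → d (q , p)

  ++-comm-⊆ : ∀ (xs : List A) {ys} → xs ++ ys ⊆ ys ++ xs
  ++-comm-⊆ xs {ys} = [ ∈-++⁺ʳ ys , ∈-++⁺ˡ ]′ ∘ ∈-++⁻ xs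

  unique⊆⇒length≤ : ∀ {xs ys : List A} → Unique xs → xs ⊆ ys → length xs ≤ length ys
  unique⊆⇒length≤ {xs} {ys} u sub = Fin.injective⇒≤ {f = λ i → index (sub (∈-lookup i))}
    λ {i} {j} eq → lookup-injective u (trans (lookup-index (sub (∈-lookup i)))
      (trans (cong (lookup ys) eq) (sym (lookup-index (sub (∈-lookup j))))))

∣p∪q∣≤∣p∣+∣q∣ : ∀ {n} (p q : Subset n) → ∣ p ∪ q ∣ ≤ ∣ p ∣ + ∣ q ∣
∣p∪q∣≤∣p∣+∣q∣ []          []          = ℕ.≤-refl
∣p∪q∣≤∣p∣+∣q∣ (true  ∷ p) (true  ∷ q) =
  s≤s (ℕ.≤-trans (∣p∪q∣≤∣p∣+∣q∣ p q) (ℕ.+-monoʳ-≤ ∣ p ∣ (ℕ.n≤1+n ∣ q ∣)))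
∣p∪q∣≤∣p∣+∣q∣ (true  ∷ p) (false ∷ q) = s≤s (∣p∪q∣≤∣p∣+∣q∣ p q)
∣p∪q∣≤∣p∣+∣q∣ (false ∷ p) (true  ∷ q) =
  ℕ.≤-trans (s≤s (∣p∪q∣≤∣p∣+∣q∣ p q)) (ℕ.≤-reflexive (sym (ℕ.+-suc ∣ p ∣ ∣ q ∣)))
∣p∪q∣≤∣p∣+∣q∣ (false ∷ p) (false ∷ q) = ∣p∪q∣≤∣p∣+∣q∣ p q

-- Menger's theorem.

module _ {n : ℕ} where

  open DecMembership (_≟_ {n}) using (_∈?_)

  private
    V = Fin n
    Edges = List (V × V)

  Edge : Edges → Rel V 0ℓ
  Edge E x y = (x , y) ∈ E

  map-walk : ∀ {R Q : Rel V 0ℓ} → (∀ {x y} → R x y → Q x y) →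
    ∀ {a b l} → Walk R a b l → Walk Q a b l
  map-walk f []      = []
  map-walk f (r ∷ w) = f r ∷ map-walk f w

  -- Göring's proof of Menger's theorem: if S separates A from B once the edge
  -- (x , y) is deleted, then any separator of A from x ∷ S, or of y ∷ S from B,
  -- in the smaller graph separates A from B in the original one.
  module _ {E : Edges} {A B : Pred V 0ℓ} {x y : V} {S : List V}
    (S-sep : Separates (Edge E) A B S) where

    sep-from-sources : ∀ {T} → Separates (Edge E) A (_∈ x ∷ S) T →
      Separates (Edge ((x , y) ∷ E)) A B T
    sep-from-sources {T} T-sep {a} Aa Bb b∉T = go ε ε
      where
      -- `p` and `q` are the same initial part of the walk. Before the walk reaches `x ∷ S` it
      -- cannot use the edge (x , y), which departs from x.
      go : ∀ {c} → Star (avoiding (Edge E) T) a c → Star (avoiding (Edge E) S) a c →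
        ¬ Star (avoiding (Edge ((x , y) ∷ E)) T) c _
      go p q ε with _ ∈? S
      ... | yes b∈S = T-sep Aa (there b∈S) b∉T p
      ... | no  b∉S = S-sep Aa Bb b∉S q
      go {c} p q ((e , c∉T) ◅ w) with c ∈? x ∷ S
      ... | yes c∈ = T-sep Aa c∈ c∉T p
      ... | no  c∉ with e
      ...   | here refl = c∉ (here refl)
      ...   | there e∈  = go (p ◅◅ (e∈ , c∉T) ◅ ε) (q ◅◅ (e∈ , c∉ ∘ there) ◅ ε) w

    sep-from-targets : ∀ {T} → Separates (Edge E) (_∈ y ∷ S) B T →
      Separates (Edge ((x , y) ∷ E)) A B T
    sep-from-targets {T} T-sep {a} {b} Aa Bb b∉T w₀ =
      let b∉S , _ , q = go w₀ in S-sep Aa Bb b∉S q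
      where
      -- The walk is read from its end: a final part starting in `y ∷ S` contradicts `T-sep`, so
      -- neither (x , y) nor a vertex of `S` can occur.
      go : ∀ {c} → Star (avoiding (Edge ((x , y) ∷ E)) T) c b →
        b ∉ S × Star (avoiding (Edge E) T) c b × Star (avoiding (Edge E) S) c b
      go ε = (λ b∈S → T-sep (there b∈S) Bb b∉T ε) , ε , ε
      go ((e , c∉T) ◅ w) with go w | e
      ... | b∉S , p , q | here refl = contradiction p (T-sep (here refl) Bb b∉T)
      ... | b∉S , p , q | there e∈  =
        b∉S , (e∈ , c∉T) ◅ p , (e∈ , λ c∈S → T-sep (there c∈S) Bb b∉T ((e∈ , c∉T) ◅ p)) ◅ q

    module _ (P : Linkage (Edge E) A (_∈ x ∷ S) (suc (length S)))
             (Q : Linkage (Edge E) (_∈ y ∷ S) B (suc (length S)))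
             (P-end : ∀ i → target P i ≡ lookup (x ∷ S) i)
             (Q-start : ∀ i → source Q i ≡ lookup (y ∷ S) i) where

      private
        P-path Q-path : Fin (suc (length S)) → List V
        P-path i = source P i ∷ tail P i
        Q-path i = source Q i ∷ tail Q i

        P-at : ∀ {i z} → z ∈ P-path i → (z∈S : z ∈ S) → i ≡ suc (index z∈S)
        P-at z∈P z∈S = disjoint P z∈P (subst (_∈ P-path (suc (index z∈S)))
          (trans (P-end _) (sym (lookup-index z∈S))) (target-path P _))

        Q-at : ∀ {i z} → z ∈ Q-path i → (z∈S : z ∈ S) → i ≡ suc (index z∈S)
        Q-at z∈Q z∈S = disjoint Q z∈Q
          (here (trans (lookup-index z∈S) (sym (Q-start _))))

        P-ends : ∀ {i z} → z ∈ P-path i → z ∈ S → z ≡ target P i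
        P-ends z∈P z∈S = trans (lookup-index z∈S)
          (trans (sym (P-end _)) (cong (target P) (sym (P-at z∈P z∈S))))

        Q-starts : ∀ {i z} → z ∈ Q-path i → z ∈ S → z ≡ source Q i
        Q-starts z∈Q z∈S = trans (lookup-index z∈S)
          (trans (sym (Q-start _)) (cong (source Q) (sym (Q-at z∈Q z∈S))))

        -- At a common vertex outside `S`, the `P`-path up to it and the `Q`-path behind it would
        -- lead from A to B past `S`, against `S-sep`.
        meet∈S : ∀ {i j z} → z ∈ P-path i → z ∈ Q-path j → z ∈ S
        meet∈S {i} {j} {z} z∈P z∈Q with z ∈? S
        ... | yes z∈S = z∈S
        ... | no  z∉S =
          let q , b∉S = suffix-avoids (walk Q j) tail∉S z∈Q z∉S
          in contradiction (prefix-avoids (walk P i) (unique P i) P-ends z∈P ◅◅ q)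
               (S-sep (source∈ P i) (target∈ Q j) b∉S)
          where
          tail∉S : ∀ {w} → w ∈ tail Q j → w ∉ S
          tail∉S w∈ w∈S = head∉tail (unique Q j)
            (subst (_∈ tail Q j) (Q-starts (there w∈) w∈S) w∈)

        -- The paths with index zero end at x and start at y; the new edge joins them and both ends
        -- are listed. Every other pair shares a vertex of `S`, which must be listed once.
        joined-tail : Fin (suc (length S)) → List V
        joined-tail zero    = tail P zero ++ source Q zero ∷ tail Q zero
        joined-tail (suc i) = tail P (suc i) ++ tail Q (suc i)

        joined-walk : ∀ i → Walk (Edge ((x , y) ∷ E)) (source P i) (target Q i) (joined-tail i)
        joined-walk zero    = map-walk there (walk P zero)
          ++ʷ here (cong₂ _,_ (P-end zero) (Q-start zero)) ∷ map-walk there (walk Q zero)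
        joined-walk (suc i) = map-walk there (walk P (suc i)) ++ʷ
          subst (λ v → Walk _ v _ _) (trans (Q-start (suc i)) (sym (P-end (suc i))))
            (map-walk there (walk Q (suc i)))

        joined-unique : ∀ i → Unique (source P i ∷ joined-tail i)
        joined-unique zero = Unique.++⁺ (unique P zero) (unique Q zero)
          λ (z∈P , z∈Q) → case P-at z∈P (meet∈S z∈P z∈Q) of λ ()
        joined-unique (suc i) = Unique.++⁺ (unique P (suc i)) (AllPairs.tail (unique Q (suc i)))
          λ (z∈P , z∈Q) → head∉tail (unique Q (suc i))
            (subst (_∈ tail Q (suc i)) (Q-starts (there z∈Q) (meet∈S z∈P (there z∈Q))) z∈Q)

        joined-⊆ : ∀ i {z} → z ∈ source P i ∷ joined-tail i → z ∈ P-path i ⊎ z ∈ Q-path i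
        joined-⊆ zero    z∈ = ∈-++⁻ (P-path zero) z∈
        joined-⊆ (suc i) z∈ = Sum.map₂ there (∈-++⁻ (P-path (suc i)) z∈)

        same-index : ∀ {i j z} → z ∈ P-path i → z ∈ Q-path j → i ≡ j
        same-index z∈P z∈Q = trans (P-at z∈P z∈S) (sym (Q-at z∈Q z∈S))
          where z∈S = meet∈S z∈P z∈Q

        joined-disjoint : ∀ {i j z} → z ∈ source P i ∷ joined-tail i →
          z ∈ source P j ∷ joined-tail j → i ≡ j
        joined-disjoint {i} {j} z∈i z∈j with joined-⊆ i z∈i | joined-⊆ j z∈j
        ... | inj₁ p | inj₁ p′ = disjoint P p p′
        ... | inj₁ p | inj₂ q  = same-index p q
        ... | inj₂ q | inj₁ p  = sym (same-index p q)
        ... | inj₂ q | inj₂ q′ = disjoint Q q q′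

      join : Linkage (Edge ((x , y) ∷ E)) A B (suc (length S))
      join = record
        { source   = source P
        ; target   = target Q
        ; tail     = joined-tail
        ; walk     = joined-walk
        ; unique   = joined-unique
        ; source∈  = source∈ P
        ; target∈  = target∈ Q
        ; disjoint = joined-disjoint
        }

  weaken : ∀ {R Q : Rel V 0ℓ} {A B k} → (∀ {x y} → R x y → Q x y) →
    Linkage R A B k → Linkage Q A B k
  weaken f L = record
    { source   = source L
    ; target   = target L
    ; tail     = tail L
    ; walk     = map-walk f ∘ walk L
    ; unique   = unique L
    ; source∈  = source∈ L
    ; target∈  = target∈ L
    ; disjoint = disjoint L
    }

  targets-injective : ∀ {R : Rel V 0ℓ} {A B k} (L : Linkage R A B k) →
    Injective _≡_ _≡_ (target L)
  targets-injective L {i} {j} eq =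
    disjoint L (target-path L i) (subst (_∈ _) (sym eq) (target-path L j))

  sources-injective : ∀ {R : Rel V 0ℓ} {A B k} (L : Linkage R A B k) →
    Injective _≡_ _≡_ (source L)
  sources-injective L eq = disjoint L (here refl) (here eq)

  -- Induction on the edges. Given a separator `S` of the graph without (x , y), the induction
  -- hypothesis is applied from A to `x ∷ S` and from `y ∷ S` to B; a small separator of either kind
  -- survives the new edge, and two linkages can be joined.
  menger : ∀ {A B : Pred V 0ℓ} → Decidable A → Decidable B → ∀ E k →
    Linkage (Edge E) A B k ⊎ ∃[ T ] length T < k × Separates (Edge E) A B T
  menger A? B? [] k = by-size (k ≤? length common)
    where
    A∩B? = λ v → A? v ×-dec B? v
    common = filter A∩B? (allFin n)
    common! = Unique.filter⁺ A∩B? (Unique.allFin⁺ n)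
    common∈ = λ i → proj₂ (∈-filter⁻ A∩B? {xs = allFin n} (∈-lookup {xs = common} i))

    -- Without edges, the paths are the single vertices of A ∩ B, and all of these together separate
    -- A from B.
    by-size : Dec (k ≤ length common) →
      Linkage (Edge []) _ _ k ⊎ ∃[ T ] length T < k × Separates (Edge []) _ _ T
    by-size (yes k≤) = inj₁ record
      { source   = vertex
      ; target   = vertex
      ; tail     = λ _ → []
      ; walk     = λ _ → []
      ; unique   = λ _ → [] ∷ []
      ; source∈  = λ _ → proj₁ (common∈ _)
      ; target∈  = λ _ → proj₂ (common∈ _)
      ; disjoint = λ { (here refl) (here eq) →
          Fin.inject≤-injective k≤ k≤ _ _ (lookup-injective common! eq) }
      }
      where vertex = λ i → lookup common (inject≤ i k≤)
    by-size (no k≰) = inj₂ (common , ℕ.≰⇒> k≰ ,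
      λ { Aa Bb b∉ ε → b∉ (∈-filter⁺ A∩B? (∈-allFin _) (Aa , Bb)) ; _ _ _ ((() , _) ◅ _) })
  menger A? B? ((x , y) ∷ E) k with menger A? B? E k
  ... | inj₁ L = inj₁ (weaken there L)
  ... | inj₂ (S , S<k , S-sep)
    with menger A? (_∈? x ∷ S) E k | menger (_∈? y ∷ S) B? E k
  ...   | inj₂ (T , T<k , T-sep) | _ = inj₂ (T , T<k , sep-from-sources S-sep T-sep)
  ...   | _ | inj₂ (T , T<k , T-sep) = inj₂ (T , T<k , sep-from-targets S-sep T-sep)
  ...   | inj₁ P | inj₁ Q =
    -- The k distinct targets of `P` lie in `x ∷ S`, which has at most k entries. Hence k is
    -- `suc (length S)`, and both linkages can be reindexed by positions in these lists.
    let f , f-inj , P-end   = inverse-lookup (target P) (targets-injective P) (target∈ P) S<k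
        g , g-inj , Q-start = inverse-lookup (source Q) (sources-injective Q) (source∈ Q) S<k
    in inj₁ (subst (Linkage _ _ _) (ℕ.≤-antisym S<k (Fin.injective⇒≤ {f = index ∘ target∈ P}
         (λ eq → targets-injective P (trans (lookup-index (target∈ P _))
           (trans (cong (lookup (x ∷ S)) eq) (sym (lookup-index (target∈ P _))))))))
         (join S-sep (reindex P f f-inj) (reindex Q g g-inj) P-end Q-start))

  -- Pigeonhole; cutting, reversing and rotating walks.

  ∃-∉ : ∀ {xs T : List V} → Unique xs → length T < length xs → ∃[ w ] w ∈ xs × w ∉ T
  ∃-∉ {xs} {T} u T<xs with All.all? (_∈? T) xs
  ... | yes all = contradiction (unique⊆⇒length≤ u (All.lookup all)) (ℕ.<⇒≱ T<xs)
  ... | no ¬all =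
    let w , w∈ , w∉ = find (¬All⇒Any¬ (_∈? T) xs ¬all) in w , w∈ , w∉

  module _ {R : Rel V 0ℓ} where

    split : ∀ {a b z l} → Walk R a b l → z ∈ a ∷ l →
      ∃₂ λ l₁ l₂ → Walk R a z l₁ × Walk R z b l₂ × l ≡ l₁ ++ l₂
    split w       (here refl) = [] , _ , [] , w , refl
    split (r ∷ w) (there z∈)  =
      let l₁ , l₂ , w₁ , w₂ , eq = split w z∈ in _ , l₂ , r ∷ w₁ , w₂ , cong (_ ∷_) eq

    trim : ∀ {B : Pred V 0ℓ} → Decidable B → ∀ {a b l} → Walk R a b l → B b →
      ∃₂ λ z l′ → Walk R a z l′ × B z × (∀ {w} → w ∈ a ∷ l′ → B w → w ≡ z)
        × a ∷ l′ ⊆ a ∷ l × (Unique (a ∷ l) → Unique (a ∷ l′))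
    trim B? {a} w Bb with B? a
    ... | yes Ba = a , [] , [] , Ba , (λ { (here eq) _ → eq }) ,
      (λ { (here eq) → here eq }) , λ _ → [] ∷ []
    trim B? [] Bb | no ¬Ba = contradiction Bb ¬Ba
    trim B? (r ∷ w) Bb | no ¬Ba =
      let z , l′ , w′ , Bz , only , sub , uniq = trim B? w Bb
      in z , _ , r ∷ w′ , Bz ,
         (λ { (here refl) Ba → contradiction Ba ¬Ba ; (there w∈) → only w∈ }) ,
         (λ { (here eq) → here eq ; (there w∈) → there (sub w∈) }) ,
         λ u → (head∉tail u ∘ sub) ∷! uniq (AllPairs.tail u)

    reverse : Symmetric R → ∀ {a b l} → Walk R a b l → Unique (a ∷ l) →
      ∃[ l′ ] Walk R b a l′ × Unique (b ∷ l′) × b ∷ l′ ⊆ a ∷ l × a ∷ l ⊆ b ∷ l′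
    reverse R-sym []                u = [] , [] , u , id , id
    reverse R-sym {a} {b} (r ∷ w) u =
      let l′ , w′ , u′ , sub , sup = reverse R-sym w (AllPairs.tail u)
      in l′ ++ [ a ] , w′ ++ʷ (R-sym r ∷ []) ,
         Unique.++⁺ u′ ([] ∷ []) (λ { (w∈ , here refl) → head∉tail u (sub w∈) }) ,
         [ there ∘ sub , (λ { (here eq) → here eq }) ]′ ∘ ∈-++⁻ (b ∷ l′) ,
         λ { (here eq) → ∈-++⁺ʳ (b ∷ l′) (here eq) ; (there w∈) → ∈-++⁺ˡ (sup w∈) }

    rotate : ∀ {h z c} → Walk R h h c → Unique c → z ∈ c →
      ∃[ c′ ] Walk R z z c′ × Unique c′ × c ⊆ c′ × c′ ⊆ c
    rotate w u z∈ with split w (there z∈)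
    ... | l₁ , l₂ , w₁ , w₂ , refl =
      l₂ ++ l₁ , w₂ ++ʷ w₁ , unique-++-comm l₁ u , ++-comm-⊆ l₁ , ++-comm-⊆ l₂

    linked : ∀ {a b l} → Walk R a b l → Linked R (a ∷ l)
    linked []      = [-]
    linked (r ∷ w) = r ∷ linked w

    unsnoc : ∀ {a b l} → Walk R a b l → ∃[ i ] a ∷ l ≡ i ∷ʳ b
    unsnoc []            = [] , refl
    unsnoc {a} (r ∷ w) = let i , eq = unsnoc w in a ∷ i , cong (a ∷_) eq

  -- Fans, and wheels from closed walks.

  record Leg (R : Rel V 0ℓ) (B : Pred V 0ℓ) (h z : V) (l : List V) : Set where
    field
      walk    : Walk R h z l
      unique  : Unique (h ∷ l)
      target∈ : B z
      only    : ∀ {w} → w ∈ l → B w → w ≡ z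

  open Leg

  module _ {G : Graph n} {u : V} where

    wheel : ∀ {h c p q r} → Walk (Adj G) h h c → Unique c → u ∉ c →
      Unique (p ∷ q ∷ r ∷ []) → p ∷ q ∷ r ∷ [] ⊆ c →
      All (Adj G u) (p ∷ q ∷ r ∷ []) → Wheel G u
    wheel []        _ _ _ sub = case sub (here refl) of λ ()
    wheel {h} {c} (e ∷ w) c! u∉ pqr! sub adj = record
      { rim = record
          { start    = h
          ; rest     = rest
          ; distinct = unique-++-comm rest (subst Unique eq c!)
          ; closed   = subst (Linked (Adj G) ∘ (h ∷_)) eq (linked (e ∷ w))
          -- Three of the vertices `h ∷ rest` are neighbours of u, so `rest` has at least two.
          ; long     = s≤s⁻¹ (ℕ.≤-trans spokes (List.length-filter (adj? G u) (h ∷ rest)))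
          }
      ; off    = u∉ ∘ subst (_ ∈_) (sym eq) ∘ ++-comm-⊆ [ h ]
      ; spokes = spokes
      }
      where
      -- The closed walk lists h last, whereas a `Cycle` lists it first.
      rest = proj₁ (unsnoc w)
      eq : c ≡ rest ∷ʳ h
      eq = proj₂ (unsnoc w)
      spokes : 3 ≤ length (filter (adj? G u) (h ∷ rest))
      spokes = unique⊆⇒length≤ pqr! λ p∈ →
        ∈-filter⁺ (adj? G u) (++-comm-⊆ rest {[ h ]} (subst (_ ∈_) eq (sub p∈))) (All.lookup adj p∈)

  -- The lists omit h, so their disjointness lets the legs share h.
  Fan : Rel V 0ℓ → Pred V 0ℓ → V → ℕ → Set
  Fan R B h k = ∃₂ λ (z : Fin k → V) (l : Fin k → List V) →
    (∀ i → Leg R B h (z i) (l i)) × (∀ {i j w} → w ∈ l i → w ∈ l j → i ≡ j)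

  -- Menger's theorem in the graph without h, from the neighbours of h to B.
  fan : ∀ {R : Rel V 0ℓ} {B : Pred V 0ℓ} {h k} →
    Decidable₂ R → Decidable B → ¬ B h →
    (∀ T → length T < k → h ∉ T → ∃[ b ] B b × b ∉ T × Star (avoiding R T) h b) →
    Fan R B h k
  fan {R} {B} {h} {k} R? B? ¬Bh reach =
    [ legs , (λ (T , T<k , T-sep) → ⊥-elim (unseparated T<k T-sep)) ]′ (menger A? B? E k)
    where
    A : Pred V 0ℓ
    A v = R h v × v ≢ h

    A? : Decidable A
    A? v = R? h v ×-dec ¬? (v ≟ h)

    Inner : Pred (V × V) 0ℓ
    Inner (x , y) = R x y × x ≢ h × y ≢ h

    inner? : Decidable Inner
    inner? (x , y) = R? x y ×-dec ¬? (x ≟ h) ×-dec ¬? (y ≟ h)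

    E = filter inner? (cartesianProduct (allFin n) (allFin n))

    inner : ∀ {x y} → Edge E x y → Inner (x , y)
    inner e = proj₂ (∈-filter⁻ inner? {xs = cartesianProduct (allFin n) (allFin n)} e)

    edge : ∀ {x y} → Inner (x , y) → Edge E x y
    edge = ∈-filter⁺ inner? (∈-cartesianProduct⁺ (∈-allFin _) (∈-allFin _))

    h∉walk : ∀ {a b l} → a ≢ h → Walk (Edge E) a b l → h ∉ a ∷ l
    h∉walk a≢h w       (here refl) = a≢h refl
    h∉walk a≢h (e ∷ w) (there h∈)  = h∉walk (proj₂ (proj₂ (inner e))) w h∈

    -- After its last visit to h, if any, the walk continues from a neighbour of h in the graph
    -- without h. As `reach` asks for a list without h, h is filtered out of `T`.
    depart : ∀ {T c b} → b ≢ h → Star (avoiding R (filter (λ v → ¬? (v ≟ h)) T)) c b →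
      (c ≢ h × Star (avoiding (Edge E) T) c b)
        ⊎ ∃[ a ] A a × Star (avoiding (Edge E) T) a b
    depart b≢h ε = inj₁ (b≢h , ε)
    depart {c = c} b≢h ((r , c∉) ◅ w) with depart b≢h w | c ≟ h
    ... | inj₂ p         | _        = inj₂ p
    ... | inj₁ (d≢h , p) | yes refl = inj₂ (_ , (r , d≢h) , p)
    ... | inj₁ (d≢h , p) | no c≢h   =
      inj₁ (c≢h , (edge (r , c≢h , d≢h) , λ c∈ → c∉ (∈-filter⁺ _ c∈ c≢h)) ◅ p)

    unseparated : ∀ {T} → length T < k → ¬ Separates (Edge E) A B T
    unseparated {T} T<k T-sep =
      let b , Bb , b∉ , w = reach (filter _ T) (ℕ.≤-<-trans (List.length-filter _ T) T<k)
                              λ h∈ → proj₂ (∈-filter⁻ (λ v → ¬? (v ≟ h)) {xs = T} h∈) refl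
          b≢h = λ b≡h → ¬Bh (subst B b≡h Bb)
          b∉T = λ b∈ → b∉ (∈-filter⁺ _ b∈ b≢h)
      in case depart b≢h w of λ
        { (inj₁ (h≢h , _))    → h≢h refl
        ; (inj₂ (a , Aa , p)) → T-sep Aa Bb b∉T p }

    legs : Linkage (Edge E) A B k → Fan R B h k
    legs L = z , l , leg , λ p q → Linkage.disjoint L (sub _ p) (sub _ q)
      where
      -- Each path is cut at its first vertex in `B`, which yields `only`.
      trimmed = λ i → trim B? (Linkage.walk L i) (Linkage.target∈ L i)
      z = proj₁ ∘ trimmed
      l = λ i → Linkage.source L i ∷ proj₁ (proj₂ (trimmed i))
      sub : ∀ i → l i ⊆ Linkage.source L i ∷ Linkage.tail L i
      sub i = let _ , _ , _ , _ , _ , ⊆ , _ = trimmed i in ⊆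
      leg : ∀ i → Leg R B h (z i) (l i)
      leg i =
        let _ , _ , w , Bz , only , _ , uniq = trimmed i
            r , ≢h = Linkage.source∈ L i
        in record
          { walk    = r ∷ map-walk (proj₁ ∘ inner) w
          ; unique  = h∉walk ≢h w ∷! uniq (Linkage.unique L i)
          ; target∈ = Bz
          ; only    = only
          }

  module _ {R : Rel V 0ℓ} where

    leg-end : ∀ {B h z l} → ¬ B h → Leg R B h z l → z ∈ l
    leg-end ¬Bh P with end∈ (walk P)
    ... | here refl = contradiction (target∈ P) ¬Bh
    ... | there z∈  = z∈

    -- The cycle is the first leg, the arc and the reversed second leg. The legs meet `B` only at
    -- their ends and the arc lies in `B` behind z, so nothing repeats.
    close : Symmetric R → ∀ {B h z z′ l l′ m} → ¬ B h →
      Leg R B h z l → Leg R B h z′ l′ → Disjoint l l′ →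
      Walk R z z′ m → Unique (z ∷ m) → (∀ {w} → w ∈ m → B w) →
      ∃[ c ] Walk R h h c × Unique c × h ∈ c × l ⊆ c × m ⊆ c × l′ ⊆ c
    close R-sym {h = h} {l = l} {l′} {m} ¬Bh P P′ l#l′ arc zm! m⊆B =
      let l″ , back , back! , sub , sup = reverse R-sym (walk P′) (unique P′)
          c = l ++ m ++ l″
          m#l″ : Disjoint m l″
          m#l″ = λ (w∈m , w∈l″) → case sub (there w∈l″) of λ
            { (here refl)  → ¬Bh (m⊆B w∈m)
            ; (there w∈l′) → head∉tail back! (subst (_∈ l″) (only P′ w∈l′ (m⊆B w∈m)) w∈l″) }
          l#l″ : Disjoint l l″
          l#l″ = λ (w∈l , w∈l″) → case sub (there w∈l″) of λ
            { (here refl)  → head∉tail (unique P) w∈l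
            ; (there w∈l′) → l#l′ (w∈l , w∈l′) }
          l#m : Disjoint l m
          l#m = λ (w∈l , w∈m) →
            head∉tail zm! (subst (_∈ m) (only P w∈l (m⊆B w∈m)) w∈m)
          z′∈c = case end∈ arc of λ
            { (here refl)  → ∈-++⁺ˡ (leg-end ¬Bh P)
            ; (there z′∈m) → ∈-++⁺ʳ l (∈-++⁺ˡ z′∈m) }
          back⊆c = λ {w} (w∈ : w ∈ _ ∷ l″) → case w∈ of λ
            { (here refl) → z′∈c
            ; (there w∈)  → ∈-++⁺ʳ l (∈-++⁺ʳ m w∈) }
      in c , walk P ++ʷ arc ++ʷ back ,
         Unique.++⁺ (AllPairs.tail (unique P))
           (Unique.++⁺ (AllPairs.tail zm!) (AllPairs.tail back!) m#l″)
           (λ (w∈l , w∈) →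
             [ (λ w∈m → l#m (w∈l , w∈m)) , (λ w∈l″ → l#l″ (w∈l , w∈l″)) ]′ (∈-++⁻ m w∈)) ,
         back⊆c (sup (here refl)) , ∈-++⁺ˡ , ∈-++⁺ʳ l ∘ ∈-++⁺ˡ , back⊆c ∘ sup ∘ there

  -- Rerouting a cycle through v.

  module Rim {R : Rel V 0ℓ} (R-sym : Symmetric R)
             {N : Pred V 0ℓ} {v : V} where

    RimThrough : List V → Set
    RimThrough ps = ∃₂ λ h c → Walk R h h c × Unique c × ps ⊆ c

    -- In the application `N` is the neighbourhood of u in H; v, p and q become the ends of three
    -- spokes.
    HasRim : Set
    HasRim = ∃₂ λ p q → p ≢ q × N p × N q × RimThrough (v ∷ p ∷ q ∷ [])

    module _ {z₀ zs a b} (Z : Walk R z₀ z₀ zs) (Z! : Unique zs) (v∉Z : v ∉ zs)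
             (a≢b : a ≢ b) (Na : N a) (Nb : N b) (a∈Z : a ∈ zs) (b∈Z : b ∈ zs) where

      -- The arc m′ of the cycle is replaced by the two legs.
      detour : ∀ {z z′ l l′ m m′ p q} →
        Leg R (_∈ zs) v z l → Leg R (_∈ zs) v z′ l′ → Disjoint l l′ →
        Walk R z z′ m → Walk R z′ z m′ → Unique (m ++ m′) → m ⊆ zs →
        p ∈ l ++ m ++ l′ → q ∈ l ++ m ++ l′ → RimThrough (v ∷ p ∷ q ∷ [])
      detour {z} {z′} {l} {l′} {m} P P′ l#l′ arc arc′ mm′! m⊆ p∈ q∈ =
        let m! , m′! , m#m′ = unique-++⁻ m mm′!
            z≢z′ : z ≢ z′
            z≢z′ = λ { refl → l#l′ (leg-end v∉Z P , leg-end v∉Z P′) }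
            z∉m : z ∉ m
            z∉m = λ z∈m → case end∈ arc′ of λ
              { (here z≡z′) → z≢z′ z≡z′
              ; (there z∈m′) → m#m′ (z∈m , z∈m′) }
            c , w , c! , v∈ , l⊆c , m⊆c , l′⊆c = close R-sym v∉Z P P′ l#l′ arc (z∉m ∷! m!) m⊆
            ⊆c = λ {w} (w∈ : w ∈ l ++ m ++ l′) →
              [ l⊆c , [ m⊆c , l′⊆c ]′ ∘ ∈-++⁻ m ]′ (∈-++⁻ l w∈)
        in v , c , w , c! , λ
          { (here refl) → v∈
          ; (there (here refl)) → ⊆c p∈
          ; (there (there (here refl))) → ⊆c q∈ }

      -- The list of each arc omits its first vertex, so the three lists partition `zs`. As a and b
      -- lie on at most two arcs, a third one can be replaced.
      three-arcs : ∀ {z₁ z₂ z₃ l₁ l₂ l₃ m₁ m₂ m₃} →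
        Leg R (_∈ zs) v z₁ l₁ → Leg R (_∈ zs) v z₂ l₂ → Leg R (_∈ zs) v z₃ l₃ →
        Disjoint l₁ l₂ → Disjoint l₂ l₃ → Disjoint l₃ l₁ →
        Walk R z₁ z₂ m₁ → Walk R z₂ z₃ m₂ → Walk R z₃ z₁ m₃ →
        Unique (m₁ ++ m₂ ++ m₃) → m₁ ++ m₂ ++ m₃ ⊆ zs → zs ⊆ m₁ ++ m₂ ++ m₃ → HasRim
      three-arcs {l₁ = l₁} {l₂} {l₃} {m₁} {m₂} {m₃} P₁ P₂ P₃ #₁₂ #₂₃ #₃₁ w₁ w₂ w₃ m! m⊆ ⊆m =
        a , b , a≢b , Na , Nb , pick (∈-++⁻ m₁ (⊆m a∈Z)) (∈-++⁻ m₁ (⊆m b∈Z))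
        where
        flip# : ∀ {xs ys : List V} → Disjoint xs ys → Disjoint ys xs
        flip# d (p , q) = d (q , p)

        skip₁ : ∀ {p q} → p ∈ m₂ ++ m₃ → q ∈ m₂ ++ m₃ → RimThrough (v ∷ p ∷ q ∷ [])
        skip₁ p∈ q∈ = detour P₂ P₁ (flip# #₁₂) (w₂ ++ʷ w₃) w₁ (unique-++-comm m₁ m!)
          (m⊆ ∘ ∈-++⁺ʳ m₁) (∈-++⁺ʳ l₂ (∈-++⁺ˡ p∈)) (∈-++⁺ʳ l₂ (∈-++⁺ˡ q∈))

        m!′ : Unique ((m₁ ++ m₂) ++ m₃)
        m!′ = subst Unique (sym (List.++-assoc m₁ m₂ m₃)) m!

        skip₂ : ∀ {p q} → p ∈ m₃ ++ m₁ → q ∈ m₃ ++ m₁ → RimThrough (v ∷ p ∷ q ∷ [])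
        skip₂ p∈ q∈ = detour P₃ P₂ (flip# #₂₃) (w₃ ++ʷ w₁) w₂
          (subst Unique (sym (List.++-assoc m₃ m₁ m₂)) (unique-++-comm (m₁ ++ m₂) m!′))
          ([ m⊆ ∘ ∈-++⁺ʳ m₁ ∘ ∈-++⁺ʳ m₂ , m⊆ ∘ ∈-++⁺ˡ ]′ ∘ ∈-++⁻ m₃)
          (∈-++⁺ʳ l₃ (∈-++⁺ˡ p∈)) (∈-++⁺ʳ l₃ (∈-++⁺ˡ q∈))

        skip₃ : ∀ {p q} → p ∈ m₁ ++ m₂ → q ∈ m₁ ++ m₂ → RimThrough (v ∷ p ∷ q ∷ [])
        skip₃ p∈ q∈ = detour P₁ P₃ (flip# #₃₁) (w₁ ++ʷ w₂) w₃ m!′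
          ([ m⊆ ∘ ∈-++⁺ˡ , m⊆ ∘ ∈-++⁺ʳ m₁ ∘ ∈-++⁺ˡ ]′ ∘ ∈-++⁻ m₁)
          (∈-++⁺ʳ l₁ (∈-++⁺ˡ p∈)) (∈-++⁺ʳ l₁ (∈-++⁺ˡ q∈))

        pick : a ∈ m₁ ⊎ a ∈ m₂ ++ m₃ → b ∈ m₁ ⊎ b ∈ m₂ ++ m₃ → RimThrough (v ∷ a ∷ b ∷ [])
        pick (inj₁ a∈) (inj₁ b∈) = skip₃ (∈-++⁺ˡ a∈) (∈-++⁺ˡ b∈)
        pick (inj₂ a∈) (inj₂ b∈) = skip₁ a∈ b∈
        pick (inj₁ a∈) (inj₂ b∈) with ∈-++⁻ m₂ b∈
        ... | inj₁ b∈₂ = skip₃ (∈-++⁺ˡ a∈) (∈-++⁺ʳ m₁ b∈₂)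
        ... | inj₂ b∈₃ = skip₂ (∈-++⁺ʳ m₃ a∈) (∈-++⁺ˡ b∈₃)
        pick (inj₂ a∈) (inj₁ b∈) with ∈-++⁻ m₂ a∈
        ... | inj₁ a∈₂ = skip₃ (∈-++⁺ʳ m₁ a∈₂) (∈-++⁺ˡ b∈)
        ... | inj₂ a∈₃ = skip₂ (∈-++⁺ˡ a∈₃) (∈-++⁺ʳ m₃ b∈)

      -- Z is cut at z₁ and z₂, and the piece containing z₃ is cut again; this decides in which
      -- cyclic order the legs are taken.
      three-legs : ∀ {z₁ z₂ z₃ l₁ l₂ l₃} →
        Leg R (_∈ zs) v z₁ l₁ → Leg R (_∈ zs) v z₂ l₂ → Leg R (_∈ zs) v z₃ l₃ →
        Disjoint l₁ l₂ → Disjoint l₂ l₃ → Disjoint l₃ l₁ → HasRim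
      three-legs {l₁ = l₁} {l₂} {l₃} P₁ P₂ P₃ #₁₂ #₂₃ #₃₁
        with rotate Z Z! (target∈ P₁)
      ... | c , wc , c! , ⊆c , c⊆ with split wc (there (⊆c (target∈ P₂)))
      ... | m₁ , m₂ , w₁ , w₂ , refl with ∈-++⁻ m₁ (⊆c (target∈ P₃))
      ... | inj₁ z₃∈ with split w₁ (there z₃∈)
      ...   | k₁ , k₂ , x₁ , x₂ , refl = three-arcs P₁ P₃ P₂
              (λ (p , q) → #₃₁ (q , p)) (λ (p , q) → #₂₃ (q , p)) (λ (p , q) → #₁₂ (q , p))
              x₁ x₂ w₂ (subst Unique assoc c!)
              (c⊆ ∘ subst (_ ∈_) (sym assoc)) (subst (_ ∈_) assoc ∘ ⊆c)
              where assoc = List.++-assoc k₁ k₂ m₂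
      three-legs {l₁ = l₁} {l₂} {l₃} P₁ P₂ P₃ #₁₂ #₂₃ #₃₁
          | c , wc , c! , ⊆c , c⊆ | m₁ , m₂ , w₁ , w₂ , refl | inj₂ z₃∈ with split w₂ (there z₃∈)
      ...   | k₁ , k₂ , x₁ , x₂ , refl = three-arcs P₁ P₂ P₃ #₁₂ #₂₃ #₃₁ w₁ x₁ x₂ c! c⊆ ⊆c

      -- As x already lies on a leg, one more vertex of `N` suffices: the arc containing a is kept
      -- and the other one replaced.
      two-legs : ∀ {z₁ z₂ l₁ l₂ x} →
        Leg R (_∈ zs) v z₁ l₁ → Leg R (_∈ zs) v z₂ l₂ → Disjoint l₁ l₂ →
        x ∈ l₁ → N x → x ∉ zs → HasRim
      two-legs {l₁ = l₁} {l₂} {x} P₁ P₂ #₁₂ x∈ Nx x∉Z with rotate Z Z! (target∈ P₁)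
      ... | c , wc , c! , ⊆c , c⊆ with split wc (there (⊆c (target∈ P₂)))
      ... | m₁ , m₂ , w₁ , w₂ , refl with ∈-++⁻ m₁ (⊆c a∈Z)
      ... | inj₁ a∈ = x , a , (λ { refl → x∉Z a∈Z }) , Nx , Na ,
              detour P₁ P₂ #₁₂ w₁ w₂ c! (c⊆ ∘ ∈-++⁺ˡ) (∈-++⁺ˡ x∈) (∈-++⁺ʳ l₁ (∈-++⁺ˡ a∈))
      ... | inj₂ a∈ = x , a , (λ { refl → x∉Z a∈Z }) , Nx , Na ,
              detour P₂ P₁ (λ (p , q) → #₁₂ (q , p)) w₂ w₁ (unique-++-comm m₁ c!) (c⊆ ∘ ∈-++⁺ʳ m₁)
                (∈-++⁺ʳ l₂ (∈-++⁺ʳ m₂ x∈)) (∈-++⁺ʳ l₂ (∈-++⁺ˡ a∈))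

      -- The ear replaces the first leg up to s and so puts x on it. With `D` abstract, the two legs
      -- can exchange roles.
      reroute : ∀ {D : Pred V 0ℓ} {z₁ z₂ s l₁ l₂ w x} →
        (∀ {y} → y ∈ l₁ → D y) → (∀ {y} → y ∈ l₂ → D y) → (∀ {y} → y ∈ zs → D y) →
        Leg R (_∈ zs) v z₁ l₁ → Leg R (_∈ zs) v z₂ l₂ → Disjoint l₁ l₂ →
        Leg R D v s w → s ∈ l₁ → x ∈ w → N x → x ∉ zs → HasRim
      reroute {D} {z₁} {s = s} {l₁} {l₂} {w} l₁⊆D l₂⊆D Z⊆D P₁ P₂ #₁₂ E s∈l₁ x∈w Nx x∉Z
        with split (walk P₁) (there s∈l₁)
      ... | k₁ , k₂ , w₁ , w₂ , refl =
        two-legs P₁′ P₂ #′ (∈-++⁺ˡ x∈w) Nx x∉Z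
        where
        k! = unique-++⁻ k₁ (AllPairs.tail (unique P₁))
        s∈k₁ : s ∈ k₁
        s∈k₁ = case end∈ w₁ of λ
          { (here refl) → contradiction s∈l₁ (head∉tail (unique P₁))
          ; (there s∈)  → s∈ }
        w#k₂ : Disjoint (v ∷ w) k₂
        w#k₂ (here refl , v∈) = head∉tail (unique P₁) (∈-++⁺ʳ k₁ v∈)
        w#k₂ (there y∈w , y∈k₂) = proj₂ (proj₂ k!)
          (subst (_∈ k₁) (sym (only E y∈w (l₁⊆D (∈-++⁺ʳ k₁ y∈k₂)))) s∈k₁ , y∈k₂)
        P₁′ : Leg R (_∈ zs) v z₁ (w ++ k₂)
        P₁′ = record
          { walk    = walk E ++ʷ w₂
          ; unique  = Unique.++⁺ (unique E) (proj₁ (proj₂ k!)) w#k₂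
          ; target∈ = target∈ P₁
          ; only    = λ y∈ y∈Z → case ∈-++⁻ w y∈ of λ
              { (inj₁ y∈w) → only P₁ (subst (_∈ l₁) (sym (only E y∈w (Z⊆D y∈Z))) s∈l₁) y∈Z
              ; (inj₂ y∈k) → only P₁ (∈-++⁺ʳ k₁ y∈k) y∈Z }
          }
        #′ : Disjoint (w ++ k₂) l₂
        #′ (y∈ , y∈l₂) = case ∈-++⁻ w y∈ of λ
          { (inj₁ y∈w) → #₁₂ (s∈l₁ , subst (_∈ l₂) (only E y∈w (l₂⊆D y∈l₂)) y∈l₂)
          ; (inj₂ y∈k) → #₁₂ (∈-++⁺ʳ k₁ y∈k , y∈l₂) }

      -- The ear meets the legs and Z only at s. If s is on no leg, it is on Z and the ear is a
      -- third leg.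
      legs-and-ear : ∀ {z₁ z₂ s l₁ l₂ w x} →
        Leg R (_∈ zs) v z₁ l₁ → Leg R (_∈ zs) v z₂ l₂ → Disjoint l₁ l₂ →
        Leg R (_∈ l₁ ++ l₂ ++ zs) v s w → x ∈ w → N x → x ∉ zs → HasRim
      legs-and-ear {s = s} {l₁} {l₂} {w} P₁ P₂ #₁₂ E x∈ Nx x∉Z
        with s ∈? l₁ | s ∈? l₂
      ... | yes s∈l₁ | _ =
        reroute ∈-++⁺ˡ (∈-++⁺ʳ l₁ ∘ ∈-++⁺ˡ) (∈-++⁺ʳ l₁ ∘ ∈-++⁺ʳ l₂) P₁ P₂ #₁₂ E s∈l₁ x∈ Nx x∉Z
      ... | no _ | yes s∈l₂ =
        reroute (∈-++⁺ʳ l₁ ∘ ∈-++⁺ˡ) ∈-++⁺ˡ (∈-++⁺ʳ l₁ ∘ ∈-++⁺ʳ l₂) P₂ P₁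
          (λ (p , q) → #₁₂ (q , p)) E s∈l₂ x∈ Nx x∉Z
      ... | no s∉l₁ | no s∉l₂ = three-legs P₁ P₂ E′ #₁₂
        (λ (y∈l₂ , y∈w) → s∉l₂ (subst (_∈ l₂) (only E y∈w (∈-++⁺ʳ l₁ (∈-++⁺ˡ y∈l₂))) y∈l₂))
        (λ (y∈w , y∈l₁) → s∉l₁ (subst (_∈ l₁) (only E y∈w (∈-++⁺ˡ y∈l₁)) y∈l₁))
        where
        E′ : Leg R (_∈ zs) v s w
        E′ = record
          { walk    = walk E
          ; unique  = unique E
          ; target∈ = [ (λ s∈ → contradiction s∈ s∉l₁) ,
              [ (λ s∈ → contradiction s∈ s∉l₂) , id ]′ ∘ ∈-++⁻ l₂ ]′ (∈-++⁻ l₁ (target∈ E))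
          ; only    = λ y∈w → only E y∈w ∘ ∈-++⁺ʳ l₁ ∘ ∈-++⁺ʳ l₂
          }

  -- Augmenting paths.

  module _ {R : Rel V 0ℓ} (R-sym : Symmetric R) {D : Pred V 0ℓ} {v x : V} where

    private
      D⁺ : Pred V 0ℓ
      D⁺ y = y ≡ v ⊎ D y

    -- Augmenting path: the tail v → y of the leg from v to x takes over the part of
    -- the first leg behind y.
    ear-at : ∀ {y t₁ t₂ r f₁ f₂} → ¬ D x → x ≢ v →
      Walk R v y r → Unique (v ∷ r) → (∀ {q} → q ∈ v ∷ r → ¬ D q) →
      Leg R D⁺ x t₁ f₁ → Leg R D⁺ x t₂ f₂ → Disjoint f₁ f₂ →
      (∀ {q} → q ∈ v ∷ r → q ∈ x ∷ f₁ ++ f₂ → q ≡ y) → y ∈ x ∷ f₁ →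
      ∃₂ λ s w → Leg R D v s w × x ∈ w
    ear-at {y} {t₁} {t₂} {r} {f₁} {f₂} ¬Dx x≢v r-walk r! r∌D F₁ F₂ #₁₂ r-only y∈
      with split (walk F₁) y∈
    ... | g₁ , g₂ , w₁ , w₂ , refl
      with reverse R-sym w₁ (proj₁ (unique-++⁻ (x ∷ g₁) (unique F₁)))
    ... | g′ , back , back! , sub , sup = t₂ , r ++ g′ ++ f₂ , record
      { walk    = r-walk ++ʷ back ++ʷ walk F₂
      ; unique  = Unique.++⁺ r! (Unique.++⁺ (AllPairs.tail back!) (AllPairs.tail (unique F₂)) g′#f₂)
          λ (q∈r , q∈) →
            [ (λ q∈g′ → r#g′ (q∈r , q∈g′)) , (λ q∈f₂ → r#f₂ (q∈r , q∈f₂)) ]′ (∈-++⁻ g′ q∈)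
      ; target∈ = Dt₂
      ; only    = λ q∈ Dq → [ (λ q∈r → contradiction Dq (r∌D (there q∈r))) ,
          [ (λ q∈g′ → contradiction Dq (g′∌D q∈g′)) , (λ q∈f₂ → only F₂ q∈f₂ (inj₂ Dq)) ]′
          ∘ ∈-++⁻ g′ ]′ (∈-++⁻ r q∈)
      } , x∈
      where
      ¬D⁺x : ¬ D⁺ x
      ¬D⁺x = [ x≢v , ¬Dx ]′

      y∉f₂ : y ∉ f₂
      y∉f₂ y∈f₂ = case y∈ of λ
        { (here refl)  → head∉tail (unique F₂) y∈f₂
        ; (there y∈f₁) → #₁₂ (y∈f₁ , y∈f₂) }

      r#f₂ : Disjoint (v ∷ r) f₂
      r#f₂ (q∈r , q∈f₂) =
        y∉f₂ (subst (_∈ f₂) (r-only q∈r (there (∈-++⁺ʳ (g₁ ++ g₂) q∈f₂))) q∈f₂)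

      g′⊆ : g′ ⊆ x ∷ g₁
      g′⊆ = sub ∘ there

      r#g′ : Disjoint (v ∷ r) g′
      r#g′ (q∈r , q∈g′) = head∉tail back! (subst (_∈ g′)
        (r-only q∈r (∈-++⁺ˡ {xs = x ∷ g₁ ++ g₂} (∈-++⁺ˡ (g′⊆ q∈g′)))) q∈g′)

      g′#f₂ : Disjoint g′ f₂
      g′#f₂ (q∈g′ , q∈f₂) with g′⊆ q∈g′
      ... | here refl = head∉tail (unique F₂) q∈f₂
      ... | there q∈  = #₁₂ (∈-++⁺ˡ q∈ , q∈f₂)

      -- On the first leg only its end can be in `D`, and this is y or comes after y, whereas `g′`
      -- runs from y, exclusive, back to x.
      g′∌D : ∀ {q} → q ∈ g′ → ¬ D q
      g′∌D {q} q∈g′ Dq with g′⊆ q∈g′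
      ... | here refl = ¬Dx Dq
      ... | there q∈g₁ with only F₁ (∈-++⁺ˡ q∈g₁) (inj₂ Dq)
      ...   | refl with end∈ w₂
      ...     | here refl = r#g′ (end∈ r-walk , q∈g′)
      ...     | there q∈g₂ =
        proj₂ (proj₂ (unique-++⁻ (x ∷ g₁) (unique F₁))) (there q∈g₁ , q∈g₂)

      t₂∈ : t₂ ∈ f₂
      t₂∈ = leg-end ¬D⁺x F₂

      -- The second leg cannot end at v, since `f₂` misses the whole of `v ∷ r`.
      Dt₂ : D t₂
      Dt₂ = case target∈ F₂ of λ
        { (inj₁ refl) → contradiction (here refl , t₂∈) r#f₂
        ; (inj₂ Dt)   → Dt }

      x∈ : x ∈ r ++ g′ ++ f₂
      x∈ with sup (here refl)
      ... | there x∈g′ = ∈-++⁺ʳ r (∈-++⁺ˡ x∈g′)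
      ... | here refl with end∈ r-walk
      ...   | here x≡v = contradiction x≡v x≢v
      ...   | there x∈r = ∈-++⁺ˡ x∈r

    -- The walk from v is cut at its first vertex y on the fan. The leg containing y leads back to
    -- x, and the other leg then leads to `D`.
    ear : ∀ {l} → ¬ D x → x ≢ v →
      Walk R v x l → Unique (v ∷ l) → (∀ {q} → q ∈ v ∷ l → ¬ D q) → Fan R D⁺ x 2 →
      ∃₂ λ s w → Leg R D v s w × x ∈ w
    ear ¬Dx x≢v w w! w∌D (t , f , F , f-disjoint)
      with trim (_∈? x ∷ f zero ++ f (suc zero)) w (here refl)
    ... | y , r , r-walk , y∈ , r-only , r⊆ , r! with ∈-++⁻ (x ∷ f zero) y∈
    ...   | inj₁ y∈f₁ = ear-at ¬Dx x≢v r-walk (r! w!) (w∌D ∘ r⊆)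
            (F zero) (F (suc zero)) (λ (p , q) → case f-disjoint p q of λ ()) r-only y∈f₁
    ...   | inj₂ y∈f₂ = ear-at ¬Dx x≢v r-walk (r! w!) (w∌D ∘ r⊆)
            (F (suc zero)) (F zero) (λ (p , q) → case f-disjoint p q of λ ())
            (λ q∈ → r-only q∈ ∘ swap-tail) (there y∈f₂)
            where
            swap-tail : x ∷ f (suc zero) ++ f zero ⊆ x ∷ f zero ++ f (suc zero)
            swap-tail (here eq)  = here eq
            swap-tail (there q∈) = there (++-comm-⊆ (f (suc zero)) q∈)

  -- Vertex sets as lists and as subsets; degrees and connectivity.

  ⟦_⟧ : List V → Subset n
  ⟦ [] ⟧    = Subset.⊥
  ⟦ x ∷ T ⟧ = ⁅ x ⁆ ∪ ⟦ T ⟧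

  ∣⟦_⟧∣≤length : ∀ T → ∣ ⟦ T ⟧ ∣ ≤ length T
  ∣⟦ [] ⟧∣≤length    = ℕ.≤-reflexive (Subset.∣⊥∣≡0 n)
  ∣⟦ x ∷ T ⟧∣≤length = ℕ.≤-trans (∣p∪q∣≤∣p∣+∣q∣ ⁅ x ⁆ ⟦ T ⟧)
    (ℕ.+-mono-≤ (ℕ.≤-reflexive (Subset.∣⁅x⁆∣≡1 x)) ∣⟦ T ⟧∣≤length)

  ⟦⟧⁺ : ∀ {x T} → x ∈ T → x Subset.∈ ⟦ T ⟧
  ⟦⟧⁺ (here refl) = Subset.x∈p∪q⁺ (inj₁ (Subset.x∈⁅x⁆ _))
  ⟦⟧⁺ (there x∈)  = Subset.x∈p∪q⁺ (inj₂ (⟦⟧⁺ x∈))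

  ⟦⟧⁻ : ∀ {x} T → x Subset.∈ ⟦ T ⟧ → x ∈ T
  ⟦⟧⁻ []      x∈ = contradiction x∈ Subset.∉⊥
  ⟦⟧⁻ (y ∷ T) x∈ = [ here ∘ Subset.x∈⁅y⁆⇒x≡y y , there ∘ ⟦⟧⁻ T ]′ (Subset.x∈p∪q⁻ ⁅ y ⁆ ⟦ T ⟧ x∈)

  ∣p∪⁅x⁆∣≤1+∣p∣ : ∀ (p : Subset n) x → ∣ p ∪ ⁅ x ⁆ ∣ ≤ suc ∣ p ∣
  ∣p∪⁅x⁆∣≤1+∣p∣ p x = ℕ.≤-trans (∣p∪q∣≤∣p∣+∣q∣ p ⁅ x ⁆)
    (ℕ.≤-reflexive (trans (cong (∣ p ∣ +_) (Subset.∣⁅x⁆∣≡1 x)) (ℕ.+-comm ∣ p ∣ 1)))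

  ∃-outside : ∀ (p : Subset n) → ∣ p ∣ < n → ∃[ x ] x Subset.∉ p
  ∃-outside p p<n with Fin.any? (λ x → ¬? (x Subset.∈? p))
  ... | yes out = out
  ... | no ¬out = contradiction
    (subst (_≤ ∣ p ∣) (Subset.∣⊤∣≡n n) (Subset.p⊆q⇒∣p∣≤∣q∣ {p = Subset.⊤} λ {x} _ →
      decidable-stable (x Subset.∈? p) λ x∉ → ¬out (x , x∉)))
    (ℕ.<⇒≱ p<n)

  unique⊆⇒length≤∣p∣ : ∀ {xs} {p : Subset n} → Unique xs → (∀ {x} → x ∈ xs → x Subset.∈ p) →
    length xs ≤ ∣ p ∣
  unique⊆⇒length≤∣p∣ []           sub = z≤n
  unique⊆⇒length≤∣p∣ (x∉ ∷ xs!) sub = ℕ.≤-trans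
    (s≤s (unique⊆⇒length≤∣p∣ xs! λ y∈ →
      Subset.x∈p∧x≢y⇒x∈p-y (sub (there y∈)) (All.lookup x∉ y∈ ∘ sym)))
    (Subset.x∈p⇒∣p-x∣<∣p∣ (sub (here refl)))

  length≤degree : ∀ (G : Graph n) {u xs} → Unique xs → All (Adj G u) xs → length xs ≤ degree G u
  length≤degree G {u} xs! adj = unique⊆⇒length≤∣p∣ xs! λ {x} x∈ →
    lookup⇒[]= x (neighbours G u) (trans (lookup∘tabulate _ x)
      (dec-true (adj? G u x) (All.lookup adj x∈)))

  module _ {k : ℕ} (G : Graph n) (conn : KConnected k G) where

    connected : ∀ T → length T < k → ∀ {x y} → x ∉ T → y ∉ T → Star (avoiding (Adj G) T) x y
    connected T T<k x∉ y∉ = Star.map (λ (e , x∉ , _) → e , x∉ ∘ ⟦⟧⁺)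
      (proj₂ conn ⟦ T ⟧ (ℕ.≤-<-trans ∣⟦ T ⟧∣≤length T<k) (x∉ ∘ ⟦⟧⁻ T) (y∉ ∘ ⟦⟧⁻ T))

    -- Since ∣X∣ + 1 ≤ k < n, a vertex other than x lies outside X; the walk to it starts with the
    -- required edge.
    neighbour-outside : ∀ (X : Subset n) {x} → ∣ X ∣ < k → x Subset.∉ X →
      ∃[ y ] Adj G x y × y Subset.∉ X
    neighbour-outside X {x} X<k x∉ with ∃-outside (X ∪ ⁅ x ⁆) (ℕ.≤-<-trans
      (ℕ.≤-trans (∣p∪⁅x⁆∣≤1+∣p∣ X x) X<k) (proj₁ conn))
    ... | y , y∉ = first (λ { refl → y∉ (Subset.x∈p∪q⁺ (inj₂ (Subset.x∈⁅x⁆ _))) })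
                     (proj₂ conn X X<k x∉ (y∉ ∘ Subset.x∈p∪q⁺ ∘ inj₁))
      where
      first : ∀ {x y} → x ≢ y → Star (AdjOutside G X) x y → ∃[ z ] Adj G x z × z Subset.∉ X
      first x≢y ε                  = contradiction refl x≢y
      first x≢y ((e , _ , z∉) ◅ _) = _ , e , z∉

    neighbour : ∀ T {x} → length T < k → x ∉ T → ∃[ y ] Adj G x y × y ∉ T
    neighbour T T<k x∉ =
      let y , e , y∉ = neighbour-outside ⟦ T ⟧ (ℕ.≤-<-trans ∣⟦ T ⟧∣≤length T<k) (x∉ ∘ ⟦⟧⁻ T)
      in y , e , y∉ ∘ ⟦⟧⁺

  -- The graph H - u.

  module _ (H : Graph n) (u : V) where

    -- u remains as an isolated vertex, which keeps the vertex type.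
    Minus : Rel V 0ℓ
    Minus x y = Adj H x y × x ≢ u × y ≢ u

    minus? : Decidable₂ Minus
    minus? x y = adj? H x y ×-dec ¬? (x ≟ u) ×-dec ¬? (y ≟ u)

    minus-sym : Symmetric Minus
    minus-sym (e , x≢u , y≢u) = Graph.sym H e , y≢u , x≢u

    minus-avoids : ∀ {a b l} → Walk Minus a b l → u ∉ l
    minus-avoids ((_ , _ , y≢u) ∷ w) (here refl) = y≢u refl
    minus-avoids (_ ∷ w)             (there u∈)  = minus-avoids w u∈

    to-minus : ∀ {a b l} → Walk (Adj H) a b l → u ∉ a ∷ l → Walk Minus a b l
    to-minus []      u∉ = []
    to-minus (e ∷ w) u∉ = (e , u∉ ∘ here ∘ sym , u∉ ∘ there ∘ here ∘ sym) ∷ to-minus w (u∉ ∘ there)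

    stop-before-u : ∀ {a l} → a ≢ u → Walk (Adj H) a u l → Unique (a ∷ l) →
      ∃₂ λ x l′ → Walk Minus a x l′ × Unique (a ∷ l′) × Adj H u x × a ∷ l′ ⊆ a ∷ l
    stop-before-u a≢u []      a! = contradiction refl a≢u
    stop-before-u {a} a≢u (_∷_ {b = b} e w) a! with b ≟ u
    ... | yes refl = a , [] , [] , [] ∷ [] , Graph.sym H e , λ { (here eq) → here eq }
    ... | no b≢u   =
      let x , l′ , w′ , b! , ux , sub = stop-before-u b≢u w (AllPairs.tail a!)
      in x , b ∷ l′ , (e , a≢u , b≢u) ∷ w′ , (head∉tail a! ∘ sub) ∷! b! , ux ,
         λ { (here eq) → here eq ; (there q∈) → there (sub q∈) }

  -- A cycle of H - u through v and two neighbours of u.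

  module _ (H : Graph n) (3-conn : KConnected 3 H) {u v : V} (u≢v : u ≢ v)
           (¬uv : ¬ Adj H u v) where

    open Rim {Minus H u} (minus-sym H u) {Adj H u} {v}

    minus-connected : ∀ T → length T < 2 → ∀ {x y} → x ≢ u → y ≢ u → x ∉ T → y ∉ T →
      Star (avoiding (Minus H u) T) x y
    minus-connected T T<2 x≢u y≢u x∉ y∉ = restrict (connected H 3-conn (u ∷ T) (s≤s T<2)
        (λ { (here x≡u) → x≢u x≡u ; (there x∈) → x∉ x∈ })
        (λ { (here y≡u) → y≢u y≡u ; (there y∈) → y∉ y∈ })) y≢u
      where
      -- As `avoiding` leaves the last vertex untested, `y ≢ u` is passed along.
      restrict : ∀ {x y} → Star (avoiding (Adj H) (u ∷ T)) x y → y ≢ u →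
        Star (avoiding (Minus H u) T) x y
      restrict ε y≢u = ε
      restrict ((e , x∉) ◅ ε) y≢u = ((e , x∉ ∘ here , y≢u) , x∉ ∘ there) ◅ ε
      restrict ((e , x∉) ◅ w@((_ , z∉) ◅ _)) y≢u =
        ((e , x∉ ∘ here , z∉ ∘ here) , x∉ ∘ there) ◅ restrict w y≢u

    module _ {z₀ zs a b} (Z : Walk (Minus H u) z₀ z₀ zs) (Z! : Unique zs) (a≢b : a ≢ b)
             (ua : Adj H u a) (ub : Adj H u b) (a∈Z : a ∈ zs) (b∈Z : b ∈ zs) (v∉Z : v ∉ zs) where

      B : Pred V 0ℓ
      B y = y ∈ u ∷ zs

      -- u belongs to `B`, so a leg ending elsewhere never meets u.
      minus-leg : ∀ {z l} → z ≢ u → Leg (Adj H) B v z l → Leg (Minus H u) (_∈ zs) v z l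
      minus-leg z≢u P = record
        { walk    = to-minus H u (walk P) λ
            { (here u≡v)  → u≢v u≡v
            ; (there u∈l) → z≢u (sym (only P u∈l (here refl))) }
        ; unique  = unique P
        ; target∈ = case target∈ P of λ { (here z≡u) → contradiction z≡u z≢u ; (there z∈) → z∈ }
        ; only    = λ q∈ → only P q∈ ∘ there
        }

      -- x is the vertex before u on `P₃`. A fan from x in H - u to `D` and v augments the path from
      -- v to x, which gives an ear through x.
      leg-through-u : ∀ {z₁ z₂ l₁ l₂ l₃} →
        Leg (Minus H u) (_∈ zs) v z₁ l₁ → Leg (Minus H u) (_∈ zs) v z₂ l₂ → Leg (Adj H) B v u l₃ →
        Disjoint l₁ l₂ → Disjoint l₃ l₁ → Disjoint l₃ l₂ → HasRim
      leg-through-u {z₁} {z₂} {l₁} {l₂} {l₃} P₁ P₂ P₃ #₁₂ #₃₁ #₃₂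
        with stop-before-u H u (u≢v ∘ sym) (walk P₃) (unique P₃)
      ... | x , l′ , w , w! , ux , sub =
        let s , e , E , x∈e = ear (minus-sym H u) x∉D x≢v w w! w∌D
              (fan (minus? H u) (λ y → (y ≟ v) ⊎-dec (y ∈? D)) [ x≢v , x∉D ]′ reach)
        in legs-and-ear Z Z! v∉Z a≢b ua ub a∈Z b∈Z P₁ P₂ #₁₂ E x∈e ux x∉Z
        where
        D : List V
        D = l₁ ++ l₂ ++ zs

        x≢v : x ≢ v
        x≢v refl = ¬uv ux

        w∌D : ∀ {q} → q ∈ v ∷ l′ → q ∉ D
        w∌D (here refl) = [ head∉tail (unique P₁) , [ head∉tail (unique P₂) , v∉Z ]′ ∘ ∈-++⁻ l₂ ]′
          ∘ ∈-++⁻ l₁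
        w∌D (there q∈) with sub (there q∈)
        ... | here refl = contradiction q∈ (head∉tail w!)
        ... | there q∈₃ = [ (λ q∈₁ → #₃₁ (q∈₃ , q∈₁)) , [ (λ q∈₂ → #₃₂ (q∈₃ , q∈₂)) ,
          (λ q∈Z → minus-avoids H u w (subst (_∈ l′) (only P₃ q∈₃ (there q∈Z)) q∈)) ]′ ∘ ∈-++⁻ l₂ ]′
          ∘ ∈-++⁻ l₁

        x∉D : x ∉ D
        x∉D = w∌D (end∈ w)

        x∉Z : x ∉ zs
        x∉Z = x∉D ∘ ∈-++⁺ʳ l₁ ∘ ∈-++⁺ʳ l₂

        reach : ∀ T → length T < 2 → x ∉ T →
          ∃[ q ] (q ≡ v ⊎ q ∈ D) × q ∉ T × Star (avoiding (Minus H u) T) x q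
        -- v and z₁ are two distinct targets, and `T` misses one of them.
        reach T T<2 x∉T with ∃-∉ {xs = v ∷ z₁ ∷ []}
          ((λ { (here refl) → v∉Z (target∈ P₁) }) ∷! [] ∷ []) T<2
        ... | q , q∈ , q∉T = q , in-D⁺ q∈ , q∉T ,
          minus-connected T T<2 (λ { refl → irrefl H refl ux }) (q≢u q∈) x∉T q∉T
          where
          in-D⁺ : q ∈ v ∷ z₁ ∷ [] → q ≡ v ⊎ q ∈ D
          in-D⁺ (here eq)           = inj₁ eq
          in-D⁺ (there (here refl)) = inj₂ (∈-++⁺ʳ l₁ (∈-++⁺ʳ l₂ (target∈ P₁)))
          q≢u : q ∈ v ∷ z₁ ∷ [] → q ≢ u
          q≢u (here refl) refl         = u≢v refl
          q≢u (there (here refl)) refl = minus-avoids H u Z (target∈ P₁)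

      v∉B : ¬ B v
      v∉B (here v≡u)  = u≢v (sym v≡u)
      v∉B (there v∈Z) = v∉Z v∈Z

      off-rim : HasRim
      off-rim with fan {B = B} (adj? H) (_∈? u ∷ zs) v∉B reach
        where
        uab! : Unique (u ∷ a ∷ b ∷ [])
        uab! = (λ { (here refl) → irrefl H refl ua ; (there (here refl)) → irrefl H refl ub })
          ∷! (λ { (here a≡b) → a≢b a≡b }) ∷! [] ∷ []
        reach : ∀ T → length T < 3 → v ∉ T → ∃[ q ] B q × q ∉ T × Star (avoiding (Adj H) T) v q
        reach T T<3 v∉T =
          let q , q∈ , q∉T = ∃-∉ uab! T<3 in q , in-B q∈ , q∉T , connected H 3-conn T T<3 v∉T q∉T
          where
          in-B : ∀ {q} → q ∈ u ∷ a ∷ b ∷ [] → B q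
          in-B (here refl)                 = here refl
          in-B (there (here refl))         = there a∈Z
          in-B (there (there (here refl))) = there b∈Z
      ... | z , l , P , P# = by-targets (z i₀ ≟ u) (z i₁ ≟ u) (z i₂ ≟ u)
        where
        i₀ i₁ i₂ : Fin 3
        i₀ = zero
        i₁ = suc zero
        i₂ = suc (suc zero)

        #-legs : ∀ {i j} → i ≢ j → Disjoint (l i) (l j)
        #-legs i≢j (p , q) = i≢j (P# p q)

        through : ∀ i j k → i ≢ j → k ≢ i → k ≢ j → z k ≡ u → HasRim
        through i j k i≢j k≢i k≢j zₖ≡u = leg-through-u
          (minus-leg (z≢u k≢i) (P i)) (minus-leg (z≢u k≢j) (P j))
          (subst (λ y → Leg _ _ _ y _) zₖ≡u (P k)) (#-legs i≢j) (#-legs k≢i) (#-legs k≢j)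
          where
          z≢u : ∀ {i} → k ≢ i → z i ≢ u
          z≢u {i} k≢i zᵢ≡u = k≢i (P# (leg-end v∉B (P k))
            (subst (_∈ l i) (trans zᵢ≡u (sym zₖ≡u)) (leg-end v∉B (P i))))

        -- The legs share only v, so at most one of them ends at u.
        by-targets : Dec (z i₀ ≡ u) → Dec (z i₁ ≡ u) → Dec (z i₂ ≡ u) → HasRim
        by-targets (yes z₀≡u) _ _ = through i₁ i₂ i₀ (λ ()) (λ ()) (λ ()) z₀≡u
        by-targets (no _) (yes z₁≡u) _ = through i₀ i₂ i₁ (λ ()) (λ ()) (λ ()) z₁≡u
        by-targets (no _) (no _) (yes z₂≡u) = through i₀ i₁ i₂ (λ ()) (λ ()) (λ ()) z₂≡u
        by-targets (no z₀≢u) (no z₁≢u) (no z₂≢u) =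
          three-legs Z Z! v∉Z a≢b ua ub a∈Z b∈Z
            (minus-leg z₀≢u (P i₀)) (minus-leg z₁≢u (P i₁)) (minus-leg z₂≢u (P i₂))
            (#-legs (λ ())) (#-legs (λ ())) (#-legs (λ ()))

    -- Two paths in H - u from b to the ends of an edge aa′, closed by this edge, form a cycle
    -- through the neighbours a and b of u. If it contains v, it already serves.
    has-rim : HasRim
    has-rim with neighbour H 3-conn [] {u} (s≤s z≤n) (λ ())
    ... | a , ua , _ with neighbour H 3-conn [ a ] {u} (s≤s (s≤s z≤n))
                            (λ { (here refl) → irrefl H refl ua })
    ... | b , ub , b∉a with neighbour H 3-conn (u ∷ b ∷ []) {a} (s≤s (s≤s (s≤s z≤n)))
                              (λ { (here refl) → irrefl H refl ua
                                 ; (there (here refl)) → b∉a (here refl) })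
    ... | a′ , aa′ , a′∉ = from-fan (fan (minus? H u) (_∈? a ∷ a′ ∷ []) b∉B reach)
      where
      a≢u : a ≢ u
      a≢u refl = irrefl H refl ua

      b≢u : b ≢ u
      b≢u refl = irrefl H refl ub

      aa′! : Unique (a ∷ a′ ∷ [])
      aa′! = (λ { (here refl) → irrefl H refl aa′ }) ∷! [] ∷ []

      b∉B : b ∉ a ∷ a′ ∷ []
      b∉B (here refl)         = b∉a (here refl)
      b∉B (there (here refl)) = a′∉ (there (here refl))

      reach : ∀ T → length T < 2 → b ∉ T →
        ∃[ q ] q ∈ a ∷ a′ ∷ [] × q ∉ T × Star (avoiding (Minus H u) T) b q
      reach T T<2 b∉T =
        let q , q∈ , q∉T = ∃-∉ aa′! T<2
        in q , q∈ , q∉T , minus-connected T T<2 b≢u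
             (B⇒≢u q∈) b∉T q∉T
        where
        B⇒≢u : ∀ {q} → q ∈ a ∷ a′ ∷ [] → q ≢ u
        B⇒≢u (here refl)         = a≢u
        B⇒≢u (there (here refl)) = a′∉ ∘ here

      EdgeLeg : V → List V → Set
      EdgeLeg = Leg (Minus H u) (_∈ a ∷ a′ ∷ []) b

      from-legs : ∀ {l l′} → EdgeLeg a l → EdgeLeg a′ l′ →
        Disjoint l l′ → HasRim
      from-legs P P′ l#l′
        with close (minus-sym H u) b∉B P P′ l#l′ ((aa′ , a≢u , a′∉ ∘ here) ∷ []) aa′! there
      ... | c , Z , Z! , b∈ , l⊆ , _ with v ∈? c
      ...   | no  v∉ = off-rim Z Z! (b∉a ∘ here ∘ sym) ua ub (l⊆ (leg-end b∉B P)) b∈ v∉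
      ...   | yes v∈ = a , b , b∉a ∘ here ∘ sym , ua , ub , b , c , Z , Z! , λ
              { (here refl) → v∈
              ; (there (here refl)) → l⊆ (leg-end b∉B P)
              ; (there (there (here refl))) → b∈ }

      arrange : ∀ {z z′ l l′} → EdgeLeg z l → EdgeLeg z′ l′ →
        z ∈ a ∷ a′ ∷ [] → z′ ∈ a ∷ a′ ∷ [] → Disjoint l l′ → HasRim
      arrange P P′ (here refl)         (there (here refl)) l#l′ = from-legs P P′ l#l′
      arrange P P′ (there (here refl)) (here refl)         l#l′ =
        from-legs P′ P λ (p , q) → l#l′ (q , p)
      arrange P P′ (here refl)         (here refl)         l#l′ =
        ⊥-elim (l#l′ (leg-end b∉B P , leg-end b∉B P′))
      arrange P P′ (there (here refl)) (there (here refl)) l#l′ =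
        ⊥-elim (l#l′ (leg-end b∉B P , leg-end b∉B P′))

      from-fan : Fan (Minus H u) (_∈ a ∷ a′ ∷ []) b 2 → HasRim
      from-fan (z , l , P , P#) = arrange (P zero) (P (suc zero))
        (target∈ (P zero)) (target∈ (P (suc zero))) λ (p , q) → case P# p q of λ ()

  -- Deleting an edge uv.

  module _ (G : Graph n) {u v : V} (uv : Adj G u v) where

    private
      H = deleteEdge G u v

      u≢v : u ≢ v
      u≢v u≡v = irrefl G u≡v uv

      ¬uv : ¬ Adj H u v
      ¬uv (_ , ne) = ne (inj₁ (refl , refl))

    -- Outside a set X containing u or v, both graphs agree. For any other X it is enough that every
    -- vertex reaches u.
    delete-connected : ∀ {k} → KConnected (suc k) G → KConnected k H
    delete-connected {k} (k<n , conn) = ℕ.<-trans (ℕ.n<1+n k) k<n , by-cases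
      where
      off-edge : ∀ {X Y : Subset n} {w x y} → w ≡ u ⊎ w ≡ v → w Subset.∈ Y → X Subset.⊆ Y →
        AdjOutside G Y x y → AdjOutside H X x y
      off-edge w≡ w∈Y X⊆Y (e , x∉ , y∉) = (e , ¬same w≡) , x∉ ∘ X⊆Y , y∉ ∘ X⊆Y
        where
        ¬same : _ → ¬ SamePair u v _ _
        ¬same (inj₁ refl) (inj₁ (refl , _)) = x∉ w∈Y
        ¬same (inj₁ refl) (inj₂ (_ , refl)) = y∉ w∈Y
        ¬same (inj₂ refl) (inj₁ (_ , refl)) = y∉ w∈Y
        ¬same (inj₂ refl) (inj₂ (refl , _)) = x∉ w∈Y

      -- u has a neighbour w other than v outside X. A walk from x to w outside X ∪ {u} cannot use
      -- uv, and the edge wu completes it.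
      to-u : ∀ {X x} → ∣ X ∣ < k → u Subset.∉ X → v Subset.∉ X → x Subset.∉ X →
        Star (AdjOutside H X) x u
      to-u {X} {x} X<k u∉ v∉ x∉ with x ≟ u
      ... | yes refl = ε
      ... | no x≢u with neighbour-outside G (k<n , conn) (X ∪ ⁅ v ⁆) {u}
                          (ℕ.≤-<-trans (∣p∪⁅x⁆∣≤1+∣p∣ X v) (s≤s X<k))
                          ([ u∉ , u≢v ∘ Subset.x∈⁅y⁆⇒x≡y v ]′ ∘ Subset.x∈p∪q⁻ X ⁅ v ⁆)
      ...   | w , uw , w∉ =
        Star.map (off-edge (inj₁ refl)
            (Subset.x∈p∪q⁺ (inj₂ (Subset.x∈⁅x⁆ u))) (Subset.x∈p∪q⁺ ∘ inj₁))
          (conn (X ∪ ⁅ u ⁆) (ℕ.≤-<-trans (∣p∪⁅x⁆∣≤1+∣p∣ X u) (s≤s X<k))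
            (off-u x≢u x∉) (off-u w≢u w∉X))
        ◅◅ ((Graph.sym G uw , [ w≢u ∘ proj₁ , w≢v ∘ proj₁ ]′) , w∉X , u∉) ◅ ε
        where
        w∉X : w Subset.∉ X
        w∉X = w∉ ∘ Subset.x∈p∪q⁺ ∘ inj₁
        w≢v : w ≢ v
        w≢v refl = w∉ (Subset.x∈p∪q⁺ (inj₂ (Subset.x∈⁅x⁆ v)))
        w≢u : w ≢ u
        w≢u w≡u = irrefl G (sym w≡u) uw
        off-u : ∀ {y} → y ≢ u → y Subset.∉ X → y Subset.∉ X ∪ ⁅ u ⁆
        off-u y≢u y∉ = [ y∉ , y≢u ∘ Subset.x∈⁅y⁆⇒x≡y u ]′ ∘ Subset.x∈p∪q⁻ X ⁅ u ⁆

      by-cases : ∀ X → ∣ X ∣ < k → ConnectedOutside H X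
      by-cases X X<k x∉ y∉ with u Subset.∈? X | v Subset.∈? X
      ... | yes u∈ | _ = Star.map (off-edge (inj₁ refl) u∈ id) (conn X (ℕ.m<n⇒m<1+n X<k) x∉ y∉)
      ... | no _ | yes v∈ = Star.map (off-edge (inj₂ refl) v∈ id) (conn X (ℕ.m<n⇒m<1+n X<k) x∉ y∉)
      ... | no u∉ | no v∉ = to-u X<k u∉ v∉ x∉ ◅◅
        Star.reverse (λ (e , x∉ , y∉) → Graph.sym H e , y∉ , x∉) (to-u X<k u∉ v∉ y∉)

    wheel-at-end : KConnected 3 H → Wheel G u × 4 ≤ degree G u
    wheel-at-end 3-conn = from-rim (has-rim H 3-conn u≢v ¬uv)
      where
      v≢ : ∀ {w} → Adj H u w → v ≢ w
      v≢ (_ , ne) refl = ne (inj₁ (refl , refl))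

      from-rim : Rim.HasRim {Minus H u} (minus-sym H u) {Adj H u} {v} →
        Wheel G u × 4 ≤ degree G u
      from-rim (p , q , p≢q , up , uq , h , c , Z , Z! , ⊆c) =
        wheel (map-walk (proj₁ ∘ proj₁) Z) Z! (minus-avoids H u Z) vpq! ⊆c
          (uv ∷ proj₁ up ∷ proj₁ uq ∷ []) ,
        length≤degree G (r∉vpq ∷! vpq!) (proj₁ ur ∷ uv ∷ proj₁ up ∷ proj₁ uq ∷ [])
        where
        vpq! : Unique (v ∷ p ∷ q ∷ [])
        vpq! = (v≢ up ∷ v≢ uq ∷ []) ∷ (p≢q ∷ []) ∷ [] ∷ []
        -- A fourth neighbour of u in G, besides v, p and q.
        third = neighbour H 3-conn (p ∷ q ∷ []) {u} (s≤s (s≤s (s≤s z≤n)))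
          (λ { (here refl) → irrefl H refl up ; (there (here refl)) → irrefl H refl uq })
        r = proj₁ third
        ur = proj₁ (proj₂ third)
        r∉vpq : r ∉ v ∷ p ∷ q ∷ []
        r∉vpq (here r≡v) = v≢ ur (sym r≡v)
        r∉vpq (there r∈) = proj₂ (proj₂ third) r∈

    -- Every centre in an almost wheel-free graph has degree 3, but u is a centre of degree at least
    -- 4.
    not-almost-wheel-free : KConnected 3 H → ¬ AlmostWheelFree G
    not-almost-wheel-free 3-conn awf = refute (wheel-at-end 3-conn) awf
      where
      too-large : ∀ {w} → w ≡ u → degree G w ≡ 3 → ¬ 4 ≤ degree G u
      too-large refl d≡3 4≤d = ℕ.<⇒≢ 4≤d (sym d≡3)

      refute : Wheel G u × 4 ≤ degree G u → ¬ AlmostWheelFree G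
      refute (wh , _) (inj₁ none) = none u wh
      refute (wh , 4≤d) (inj₂ (inj₁ (_ , (W⊆ , _) , d≡3))) = too-large (W⊆ wh) d≡3 4≤d
      refute (wh , 4≤d) (inj₂ (inj₂ (_ , _ , _ , (W⊆ , _) , d≡3 , d′≡3))) =
        [ (λ eq → too-large eq d≡3 4≤d) , (λ eq → too-large eq d′≡3 4≤d) ]′ (W⊆ wh)

  -- The exact connectivity of G and of G - uv.

  connected-mono : ∀ (G : Graph n) {j k} → j ≤ k → KConnected k G → KConnected j G
  connected-mono G j≤k (k<n , conn) = ℕ.≤-<-trans j≤k k<n , λ X X<j → conn X (ℕ.<-≤-trans X<j j≤k)

  connectivity : ∀ (G : Graph n) {k} → KConnected k G → ¬ KConnected (suc k) G → HasConnectivity G k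
  connectivity G {k} conn ¬conn = conn , λ {j} conn-j →
    ℕ.≮⇒≥ λ k<j → ¬conn (connected-mono G k<j conn-j)

corollary4p6 : ∀ {n : ℕ} (G : Graph n) → KConnected 3 G → AlmostWheelFree G → MinimallyConnected 3 G
corollary4p6 {n} G 3-conn awf = κ≡3 , λ uv →
  -- The connectivity of G - uv is at least 2, as one edge is deleted, and below 3, as G is almost
  -- wheel-free.
  2 , 3 , connectivity (deleteEdge G _ _) (delete-connected G uv 3-conn)
    (λ conn → not-almost-wheel-free G uv conn awf) ,
  κ≡3 , ℕ.≤-refl
  where
  u : Fin n
  u = fromℕ< (ℕ.≤-<-trans z≤n (proj₁ 3-conn))
  κ≡3 : HasConnectivity G 3
  -- If G were 4-connected, deleting any edge would leave a 3-connected graph; an edge at u is used.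
  κ≡3 = connectivity G 3-conn λ 4-conn →
    let v , uv , _ = neighbour G 3-conn [] {u} (s≤s z≤n) (λ ())
    in not-almost-wheel-free G uv (delete-connected G uv 4-conn) awf
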